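{- Let $p\ge 1$ be an integer. For integers $\ell,r\ge1$ such that $p$ divides $r$ and $p$ does not divide $\ell$, let $C_p(\ell,r)$ be the number of configurations of period $p$ of the canonical negative-positive double Boolean automata circuit $D_{\ell,r}$ (negative left-circuit of size $\ell$, positive right-circuit of size $r$). Then $C_p(\ell,r)$ depends only on $\Delta_p=\gcd(\ell,p)$ and on $p$: if $(\ell,r)$ and $(\ell',r')$ are two such pairs with $\gcd(\ell,p)=\gcd(\ell',p)$, then $C_p(\ell,r)=C_p(\ell',r')$.
   Context: The canonical negative-positive double Boolean automata circuit $D_{\ell,r}$ has $n=\ell+r-1$ nodes $0,\ldots,n-1$. For a configuration $x=(x_0,\ldots,x_{n-1})\in\{0,1\}^n$ write $x^L=(x_0,\ldots,x_{\ell-1})$ (states of the left-circuit) and $x^R=(x_0,x_\ell,\ldots,x_{n-1})$ (states of the right-circuit, $r$ entries). All nodes are updated in parallel by $F:\{0,1\}^n\to\{0,1\}^n$: $F(x)_i=x_{i-1}$ for $i\notin\{0,\ell\}$; $F(x)_\ell=x_0$ (if $r\ge2$); and $F(x)_0=\neg a\vee b$, where $a=x_{\ell-1}$ is the last entry of $x^L$ and $b$ is the last entry of $x^R$ (so $b=x_{n-1}$ when $r\ge 2$). A configuration $x$ has period $p$ if $F^{p}(x)=x$; $p$ need not be minimal. -}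

module Defs where

open import Data.Bool.Base using (Bool; true; false; not; _∨_; if_then_else_)
open import Data.Bool.Properties using () renaming (_≟_ to _≟ᵇ_)
open import Data.Fin.Base using (Fin; zero; suc; toℕ; cast; pred; _↑ˡ_; _↑ʳ_)
open import Data.List.Base using (List; []; _∷_; length; filter; cartesianProductWith)
open import Data.List.Membership.Propositional using (_∈_)
open import Data.List.Membership.Propositional.Properties using (∈-cartesianProductWith⁺)
open import Data.List.Relation.Unary.All using ([]; _∷_)
open import Data.List.Relation.Unary.AllPairs using ([]; _∷_)
open import Data.List.Relation.Unary.Any using (here; there)
open import Data.List.Relation.Unary.Unique.Propositional using (Unique)
open import Data.List.Relation.Unary.Unique.Propositional.Properties using (cartesianProductWith⁺)
open import Data.Nat.Base using (ℕ; zero; suc; _+_; _∸_; _≡ᵇ_; NonZero)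
open import Data.Nat.GeneralisedArithmetic using (iterate)
open import Data.Nat.Properties using (+-suc)
open import Data.Vec.Base using (Vec; []; _∷_; head; last; lookup; tabulate)
open import Data.Vec.Properties using (≡-dec; ∷-injective)
open import Relation.Binary.PropositionalEquality using (_≡_; refl; sym; cong)
open import Relation.Nullary.Decidable using (Dec)

size : ℕ → ℕ → ℕ
size ℓ r = ℓ + r ∸ 1

Config : ℕ → ℕ → Set
Config ℓ r = Vec Bool (size ℓ r)

-- The left-circuit visits the nodes 0, …, ℓ-1 and the right-circuit the nodes
-- 0, ℓ, …, n-1; the two share node 0.

leftNode : ∀ ℓ r .{{_ : NonZero r}} → Fin ℓ → Fin (size ℓ r)
leftNode ℓ (suc k) i = cast (sym (cong (_∸ 1) (+-suc ℓ k))) (i ↑ˡ k)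

rightNode : ∀ ℓ r .{{_ : NonZero ℓ}} .{{_ : NonZero r}} → Fin r → Fin (size ℓ r)
rightNode ℓ@(suc _) r@(suc _) zero    = leftNode ℓ r zero
rightNode ℓ         (suc k)   (suc j) = cast (sym (cong (_∸ 1) (+-suc ℓ k))) (ℓ ↑ʳ j)

module _ (ℓ r : ℕ) .{{_ : NonZero ℓ}} .{{_ : NonZero r}} where

  leftPart : Config ℓ r → Vec Bool ℓ
  leftPart x = tabulate λ i → lookup x (leftNode ℓ r i)

  rightPart : Config ℓ r → Vec Bool r
  rightPart x = tabulate λ j → lookup x (rightNode ℓ r j)

-- Node ℓ exists only when r ≥ 2. Data.Fin.pred is i ↦ i-1 away from node 0.

F : ∀ ℓ r .{{_ : NonZero ℓ}} .{{_ : NonZero r}} → Config ℓ r → Config ℓ r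
F ℓ@(suc _) r@(suc _) x = tabulate λ i →
  if toℕ i ≡ᵇ 0 then not (last (leftPart ℓ r x)) ∨ last (rightPart ℓ r x)
  else if toℕ i ≡ᵇ ℓ then head (leftPart ℓ r x)
  else lookup x (pred i)

module _ (p ℓ r : ℕ) .{{_ : NonZero ℓ}} .{{_ : NonZero r}} where

  HasPeriod : Config ℓ r → Set
  HasPeriod x = iterate (F ℓ r) x p ≡ x

  hasPeriod? : (x : Config ℓ r) → Dec (HasPeriod x)
  hasPeriod? x = ≡-dec _≟ᵇ_ (iterate (F ℓ r) x p) x

allVecs : ∀ n → List (Vec Bool n)
allVecs zero    = [] ∷ []
allVecs (suc n) = cartesianProductWith _∷_ (false ∷ true ∷ []) (allVecs n)

-- allVecs n lists every vector exactly once, so that filtering it counts.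

allVecs-complete : ∀ {n} (x : Vec Bool n) → x ∈ allVecs n
allVecs-complete []          = here refl
allVecs-complete (false ∷ x) =
  ∈-cartesianProductWith⁺ _∷_ {false ∷ true ∷ []} (here refl) (allVecs-complete x)
allVecs-complete (true ∷ x)  =
  ∈-cartesianProductWith⁺ _∷_ {false ∷ true ∷ []} (there (here refl)) (allVecs-complete x)

allVecs-unique : ∀ n → Unique (allVecs n)
allVecs-unique zero    = [] ∷ []
allVecs-unique (suc n) =
  cartesianProductWith⁺ _∷_ ∷-injective (((λ ()) ∷ []) ∷ [] ∷ []) (allVecs-unique n)

C : ∀ p ℓ r .{{_ : NonZero ℓ}} .{{_ : NonZero r}} → ℕ
C p ℓ r = length (filter (hasPeriod? p ℓ r) (allVecs (size ℓ r)))

{-# OPTIONS --safe #-}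
module Submission where

-- The state of node i is that of node 0 some steps earlier, so a configuration
-- of period p is a p-periodic word w, read backwards in time. As p ∣ r, the rule
-- at node 0 becomes w t = ¬ w (t + ℓ) ∨ w t, that is, w t ∨ w (t + ℓ) for all t.
-- When gcd(ℓ, p) = gcd(ℓ′, p), a permutation of ℤ/p conjugates t ↦ t + ℓ′ to
-- t ↦ t + ℓ, and reindexing along it matches the words for ℓ with those for ℓ′.
-- By symmetry it suffices to see that this is injective.

open import Defs
open import Data.Bool.Base using (Bool; true; false; not; _∨_; if_then_else_)
open import Data.Bool.Properties using (if-float)
open import Data.Fin.Base using (Fin; zero; suc; toℕ; fromℕ; pred)
open import Data.Fin.Properties using (toℕ-cast; toℕ-↑ˡ; toℕ-↑ʳ; toℕ-fromℕ; toℕ-inject₁; toℕ-injective; injective⇒≤)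
open import Data.List.Base using (List; length; filter) renaming (lookup to lookupˡ)
open import Data.List.Membership.Propositional using (_∈_)
open import Data.List.Membership.Propositional.Properties using (∈-lookup; ∈-filter⁺; ∈-filter⁻)
open import Data.List.Relation.Unary.All using () renaming (lookup to lookupᵃ)
open import Data.List.Relation.Unary.AllPairs using (_∷_)
open import Data.List.Relation.Unary.Any using (index)
open import Data.List.Relation.Unary.Any.Properties using (lookup-index)
open import Data.List.Relation.Unary.Unique.Propositional using (Unique)
open import Data.List.Relation.Unary.Unique.Propositional.Properties using () renaming (filter⁺ to filter-unique)
open import Data.Nat.Base using (ℕ; zero; suc; _+_; _*_; _≤_; _≡ᵇ_; NonZero; ≢-nonZero)
open import Data.Nat.DivMod using (_/_; _%_; m≡m%n+[m/n]*n; [m+kn]%n≡m%n; m%n%n≡m%n; m%n<n; m<n⇒m/n≡0; +-distrib-/-∣ʳ; m*n/n≡m)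
open import Data.Nat.Divisibility using (_∣_; _∤_; divides; divides-refl)
open import Data.Nat.GCD using (gcd; GCD; gcd-GCD; gcd[m,n]≢0; module Bézout)
open import Data.Nat.GeneralisedArithmetic using (iterate)
open import Data.Nat.Properties using (≤-antisym; ≤-refl; <⇒≢; <⇒≤; +-assoc; +-comm; +-identityʳ; +-suc; *-comm; *-distribʳ-+; suc-injective; m+1+n≢m)
open import Data.Nat.Tactic.RingSolver using (solve-∀)
open import Data.Product.Base using (∃; ∃₂; _,_; proj₂)
open import Data.Sum.Base using (inj₂)
open import Data.Vec.Base using (Vec; last; lookup; tabulate)
open import Data.Vec.Properties using (lookup∘tabulate; tabulate∘lookup; tabulate-cong)
open import Function.Base using (_∘_; _∘′_)
open import Relation.Binary.PropositionalEquality using (_≡_; _≢_; _≗_; refl; sym; trans; cong; cong₂; subst; module ≡-Reasoning)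
open import Relation.Nullary.Negation using (contradiction)
open ≡-Reasoning

-- Congruences

infix 4 _≈_[mod_]

-- Neither side need be the larger, so a multiple of the modulus is added to both.
_≈_[mod_] : ℕ → ℕ → ℕ → Set
m ≈ n [mod p ] = ∃₂ λ j k → m + j * p ≡ n + k * p

module _ {p : ℕ} where

  ≈-reflexive : ∀ {m n} → m ≡ n → m ≈ n [mod p ]
  ≈-reflexive eq = 0 , 0 , cong (_+ 0) eq

  ≈-trans : ∀ {m n o} → m ≈ n [mod p ] → n ≈ o [mod p ] → m ≈ o [mod p ]
  ≈-trans {m} {n} {o} (j , k , eq) (j′ , k′ , eq′) = j + j′ , k + k′ , (begin
    m + (j + j′) * p      ≡⟨ regroup m j j′ p ⟩
    m + j * p + j′ * p    ≡⟨ cong (_+ j′ * p) eq ⟩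
    n + k * p + j′ * p    ≡⟨ swap n k j′ p ⟩
    n + j′ * p + k * p    ≡⟨ cong (_+ k * p) eq′ ⟩
    o + k′ * p + k * p    ≡⟨ swap o k′ k p ⟩
    o + k * p + k′ * p    ≡⟨ regroup o k k′ p ⟨
    o + (k + k′) * p      ∎)
    where
    regroup : ∀ m j j′ p → m + (j + j′) * p ≡ m + j * p + j′ * p
    regroup = solve-∀
    swap : ∀ m j j′ p → m + j * p + j′ * p ≡ m + j′ * p + j * p
    swap = solve-∀

  +-congˡ-≈ : ∀ {m n} o → m ≈ n [mod p ] → o + m ≈ o + n [mod p ]
  +-congˡ-≈ {m} {n} o (j , k , eq) = j , k ,
    trans (+-assoc o m (j * p)) (trans (cong (o +_) eq) (sym (+-assoc o n (k * p))))

  *-congʳ-≈ : ∀ {m n} o → m ≈ n [mod p ] → m * o ≈ n * o [mod p ]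
  *-congʳ-≈ {m} {n} o (j , k , eq) = j * o , k * o , (begin
    m * o + j * o * p    ≡⟨ factor m j o p ⟩
    (m + j * p) * o      ≡⟨ cong (_* o) eq ⟩
    (n + k * p) * o      ≡⟨ factor n k o p ⟨
    n * o + k * o * p    ∎)
    where
    factor : ∀ m j o p → m * o + j * o * p ≡ (m + j * p) * o
    factor = solve-∀

  +-multiple-≈ : ∀ m k → m + k * p ≈ m [mod p ]
  +-multiple-≈ m k = 0 , k , +-identityʳ _

-- Both sides are -1 modulo `suc q`. This is how the divisibility of the right size enters the
-- argument.
∣⇒pred-≈ : ∀ {q b} → suc q ∣ suc b → q ≈ b [mod suc q ]
∣⇒pred-≈ {q} {b} (divides k eq) = k , 1 , (begin
  q + k * suc q    ≡⟨ cong (q +_) eq ⟨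
  q + suc b        ≡⟨ swap q b ⟩
  b + 1 * suc q    ∎)
  where
  swap : ∀ q b → q + suc b ≡ b + 1 * suc q
  swap = solve-∀

bézout-≈ : ∀ {m q d} → GCD m (suc q) d → ∃ λ a → a * m ≈ d [mod suc q ]
bézout-≈ {m} {q} {d} g with Bézout.identity g
... | Bézout.+- x y eq = x , 0 , y , trans (+-identityʳ _) (sym eq)
-- The identity here reads `d + x * m ≡ y * suc q`, so the coefficient wanted is minus `x`, written
-- `x * q` because `q` is -1 modulo `suc q`.
... | Bézout.-+ x y eq = x * q , y , x * m , (begin
  x * q * m + y * suc q      ≡⟨ cong (x * q * m +_) eq ⟨
  x * q * m + (d + x * m)    ≡⟨ collect x q m d ⟩
  d + x * m * suc q          ∎)
  where
  collect : ∀ x q m d → x * q * m + (d + x * m) ≡ d + x * m * suc q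
  collect = solve-∀

-- A permutation of ℤ/p turning translation by ℓ′ into translation by ℓ

record Reindexing (p ℓ ℓ′ : ℕ) : Set where
  field
    ψ          : ℕ → ℕ
    ψ-period   : ∀ t k → ψ (t + k * p) ≈ ψ t [mod p ]
    ψ-shift    : ∀ t → ψ (ℓ′ + t) ≈ ℓ + ψ t [mod p ]
    -- For positive `p`, a surjection of ℤ/p is a permutation; surjectivity is the form in which
    -- words are recovered from their reindexings.
    ψ-onto     : ∀ u → ∃ λ t → ψ t ≈ u [mod p ]

-- With a ℓ′ ≡ d, the index t = t % d + (t / d) d is congruent to
-- t % d + (t / d) a ℓ′, and ψ replaces ℓ′ by ℓ in this expression.
reindexing : ∀ {q ℓ ℓ′} d .{{_ : NonZero d}} → GCD ℓ (suc q) d → GCD ℓ′ (suc q) d → Reindexing (suc q) ℓ ℓ′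
reindexing {q} {ℓ} {ℓ′} d g g′
  with bézout-≈ g | bézout-≈ g′ | GCD.commonDivisor g | GCD.commonDivisor g′
... | b , bℓ≈d | a , aℓ′≈d | divides e ℓ≡ed , divides f p≡fd | divides e′ ℓ′≡e′d , _ = record
  { ψ        = ψ
  ; ψ-period = λ t k → ≈-trans (≈-reflexive (ψ-period t k)) (+-multiple-≈ (ψ t) (k * (a * e)))
  ; ψ-shift  = λ t → ≈-trans (≈-reflexive (ψ-shift t))
      (≈-trans (+-congˡ-≈ (ψ t) e′c≈ℓ) (≈-reflexive (+-comm (ψ t) ℓ)))
  -- Each step of `d` in the argument adds `c` to the value, and `b * e′ * c ≈ b * ℓ ≈ d`. Hence
  -- `b * (u / d) * e′` such steps supply the missing `(u / d) * d`.
  ; ψ-onto   = λ u → u % d + b * (u / d) * e′ * d , onto u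
  }
  where
  p c : ℕ
  p = suc q
  c = a * ℓ

  ψ : ℕ → ℕ
  ψ t = t % d + t / d * c

  -- On each residue class modulo `d` the map is affine: the remainder stays fixed, and every step
  -- of `d` raises the quotient by one.
  ψ-+* : ∀ t k → ψ (t + k * d) ≡ ψ t + k * c
  ψ-+* t k = begin
    (t + k * d) % d + (t + k * d) / d * c
      ≡⟨ cong₂ (λ x y → x + y * c) ([m+kn]%n≡m%n t k d)
           (trans (+-distrib-/-∣ʳ t (divides-refl k)) (cong (t / d +_) (m*n/n≡m k d))) ⟩
    t % d + (t / d + k) * c
      ≡⟨ expand (t % d) (t / d) k c ⟩
    ψ t + k * c ∎
    where
    expand : ∀ x y k c → x + (y + k) * c ≡ x + y * c + k * c
    expand = solve-∀

  -- Regrouping `e′ * a * e * d` as `a * ℓ′ * e` lets `a * ℓ′ ≈ d` apply, which leaves `d * e`.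
  e′c≈ℓ : e′ * c ≈ ℓ [mod p ]
  e′c≈ℓ = ≈-trans (≈-reflexive eq) (≈-trans (*-congʳ-≈ e aℓ′≈d) (≈-reflexive (trans (*-comm d e) (sym ℓ≡ed))))
    where
    rearrange : ∀ e′ a e d → e′ * (a * (e * d)) ≡ a * (e′ * d) * e
    rearrange = solve-∀
    eq : e′ * c ≡ a * ℓ′ * e
    eq = begin
      e′ * (a * ℓ)          ≡⟨ cong (λ z → e′ * (a * z)) ℓ≡ed ⟩
      e′ * (a * (e * d))    ≡⟨ rearrange e′ a e d ⟩
      a * (e′ * d) * e      ≡⟨ cong (λ z → a * z * e) ℓ′≡e′d ⟨
      a * ℓ′ * e            ∎

  -- A translation by `p` is `f` steps of `d` and adds `f * c`. Since `c` is a multiple of `d`, the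
  -- factor `f * d` reassembles to `p`.
  ψ-period : ∀ t k → ψ (t + k * p) ≡ ψ t + k * (a * e) * p
  ψ-period t k = begin
    ψ (t + k * p)                  ≡⟨ cong (λ z → ψ (t + k * z)) p≡fd ⟩
    ψ (t + k * (f * d))            ≡⟨ cong (λ z → ψ (t + z)) (assoc k f d) ⟩
    ψ (t + k * f * d)              ≡⟨ ψ-+* t (k * f) ⟩
    ψ t + k * f * (a * ℓ)          ≡⟨ cong (λ z → ψ t + k * f * (a * z)) ℓ≡ed ⟩
    ψ t + k * f * (a * (e * d))    ≡⟨ cong (ψ t +_) (rearrange k f a e d) ⟩
    ψ t + k * (a * e) * (f * d)    ≡⟨ cong (λ z → ψ t + k * (a * e) * z) p≡fd ⟨
    ψ t + k * (a * e) * p          ∎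
    where
    assoc : ∀ k f d → k * (f * d) ≡ k * f * d
    assoc = solve-∀
    rearrange : ∀ k f a e d → k * f * (a * (e * d)) ≡ k * (a * e) * (f * d)
    rearrange = solve-∀

  ψ-shift : ∀ t → ψ (ℓ′ + t) ≡ ψ t + e′ * c
  ψ-shift t = begin
    ψ (ℓ′ + t)        ≡⟨ cong ψ (+-comm ℓ′ t) ⟩
    ψ (t + ℓ′)        ≡⟨ cong (λ z → ψ (t + z)) ℓ′≡e′d ⟩
    ψ (t + e′ * d)    ≡⟨ ψ-+* t e′ ⟩
    ψ t + e′ * c      ∎

  ψ-% : ∀ u → ψ (u % d) ≡ u % d
  ψ-% u = begin
    u % d % d + u % d / d * c    ≡⟨ cong₂ (λ x y → x + y * c) (m%n%n≡m%n u d) (m<n⇒m/n≡0 (m%n<n u d)) ⟩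
    u % d + 0                    ≡⟨ +-identityʳ _ ⟩
    u % d                        ∎

  onto : ∀ u → ψ (u % d + b * (u / d) * e′ * d) ≈ u [mod p ]
  onto u = ≈-trans (≈-reflexive eq)
    (≈-trans (+-congˡ-≈ (u % d) (≈-trans (*-congʳ-≈ (b * v) e′c≈ℓ)
      (≈-trans (≈-reflexive (rearrange ℓ b v)) (*-congʳ-≈ v bℓ≈d))))
      (≈-reflexive (trans (cong (u % d +_) (*-comm d v)) (sym (m≡m%n+[m/n]*n u d)))))
    where
    v : ℕ
    v = u / d
    rearrange : ∀ ℓ b v → ℓ * (b * v) ≡ b * ℓ * v
    rearrange = solve-∀
    move : ∀ z e′ c → z * e′ * c ≡ e′ * c * z
    move = solve-∀
    eq : ψ (u % d + b * v * e′ * d) ≡ u % d + e′ * c * (b * v)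
    eq = begin
      ψ (u % d + b * v * e′ * d)      ≡⟨ ψ-+* (u % d) (b * v * e′) ⟩
      ψ (u % d) + b * v * e′ * c      ≡⟨ cong₂ _+_ (ψ-% u) (move (b * v) e′ c) ⟩
      u % d + e′ * c * (b * v)        ∎

-- Iterates of a map

module _ {A : Set} (f : A → A) where

  iterate-+ : ∀ x m n → iterate f x (m + n) ≡ iterate f (iterate f x m) n
  iterate-+ x zero    n = refl
  iterate-+ x (suc m) n = iterate-+ (f x) m n

  iterate-suc : ∀ x n → iterate f x (suc n) ≡ f (iterate f x n)
  iterate-suc x zero    = refl
  iterate-suc x (suc n) = iterate-suc (f x) n

  module _ p {x} (period : iterate f x p ≡ x) where

    iterate-multiple : ∀ k → iterate f x (k * p) ≡ x
    iterate-multiple zero    = refl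
    iterate-multiple (suc k) = begin
      iterate f x (p + k * p)              ≡⟨ iterate-+ x p (k * p) ⟩
      iterate f (iterate f x p) (k * p)    ≡⟨ cong (λ y → iterate f y (k * p)) period ⟩
      iterate f x (k * p)                  ≡⟨ iterate-multiple k ⟩
      x                                    ∎

    iterate-+-multiple : ∀ m k → iterate f x (m + k * p) ≡ iterate f x m
    iterate-+-multiple m k = begin
      iterate f x (m + k * p)              ≡⟨ cong (iterate f x) (+-comm m (k * p)) ⟩
      iterate f x (k * p + m)              ≡⟨ iterate-+ x (k * p) m ⟩
      iterate f (iterate f x (k * p)) m    ≡⟨ cong (λ y → iterate f y m) (iterate-multiple k) ⟩
      iterate f x m                        ∎

    iterate-cong-≈ : ∀ {m n} → m ≈ n [mod p ] → iterate f x m ≡ iterate f x n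
    iterate-cong-≈ {m} {n} (j , k , eq) = begin
      iterate f x m              ≡⟨ iterate-+-multiple m j ⟨
      iterate f x (m + j * p)    ≡⟨ cong (iterate f x) eq ⟩
      iterate f x (n + k * p)    ≡⟨ iterate-+-multiple n k ⟩
      iterate f x n              ∎

    iterate-period : ∀ m → iterate f (iterate f x m) p ≡ iterate f x m
    iterate-period m = begin
      iterate f (iterate f x m) p    ≡⟨ iterate-+ x m p ⟨
      iterate f x (m + p)            ≡⟨ cong (iterate f x) (cong (m +_) (sym (+-identityʳ p))) ⟩
      iterate f x (m + 1 * p)        ≡⟨ iterate-+-multiple m 1 ⟩
      iterate f x m                  ∎

-- Admissible words

-- A word on ℤ/p is encoded as a function on ℕ constant on congruence classes, so that indices never
-- have to be reduced.
record Admissible (p ℓ : ℕ) (w : ℕ → Bool) : Set where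
  field
    respects : ∀ {m n} → m ≈ n [mod p ] → w m ≡ w n
    covers   : ∀ t → w t ∨ w (ℓ + t) ≡ true

open Admissible

shift-admissible : ∀ {p ℓ w} s → Admissible p ℓ w → Admissible p ℓ (λ i → w (s + i))
shift-admissible {ℓ = ℓ} {w} s adm = record
  { respects = λ m≈n → respects adm (+-congˡ-≈ s m≈n)
  ; covers   = λ t → trans (cong (λ z → w (s + t) ∨ w z) (swap s ℓ t)) (covers adm (s + t))
  }
  where
  swap : ∀ s ℓ t → s + (ℓ + t) ≡ ℓ + (s + t)
  swap = solve-∀

module _ {p ℓ ℓ′} (R : Reindexing p ℓ ℓ′) where
  open Reindexing R

  ψ-cong : ∀ {m n} → m ≈ n [mod p ] → ψ m ≈ ψ n [mod p ]
  ψ-cong {m} {n} (j , k , eq) = ≈-trans (≈-sym (ψ-period m j))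
    (≈-trans (≈-reflexive (cong ψ eq)) (ψ-period n k))
    where
    ≈-sym : ∀ {m n} → m ≈ n [mod p ] → n ≈ m [mod p ]
    ≈-sym (j , k , eq) = k , j , sym eq

  reindex-admissible : ∀ {w} → Admissible p ℓ w → Admissible p ℓ′ (w ∘ ψ)
  reindex-admissible {w} adm = record
    { respects = λ m≈n → respects adm (ψ-cong m≈n)
    ; covers   = λ t → trans (cong (w (ψ t) ∨_) (respects adm (ψ-shift t))) (covers adm (ψ t))
    }

  -- Every index is congruent to a value of `ψ`, and there the two words agree.
  reindex-injective : ∀ {w v} → Admissible p ℓ w → Admissible p ℓ v → w ∘ ψ ≗ v ∘ ψ → w ≗ v
  reindex-injective {w} {v} w-adm v-adm eq u with ψ-onto u
  ... | t , ψt≈u = begin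
    w u        ≡⟨ respects w-adm ψt≈u ⟨
    w (ψ t)    ≡⟨ eq t ⟩
    v (ψ t)    ≡⟨ respects v-adm ψt≈u ⟩
    v u        ∎

-- Configurations of period p as admissible words

≢⇒≡ᵇ-false : ∀ {m n} → m ≢ n → (m ≡ᵇ n) ≡ false
≢⇒≡ᵇ-false {zero}  {zero}  m≢n = contradiction refl m≢n
≢⇒≡ᵇ-false {zero}  {suc n} m≢n = refl
≢⇒≡ᵇ-false {suc m} {zero}  m≢n = refl
≢⇒≡ᵇ-false {suc m} {suc n} m≢n = ≢⇒≡ᵇ-false (m≢n ∘′ cong suc)

≡ᵇ-refl : ∀ n → (n ≡ᵇ n) ≡ true
≡ᵇ-refl zero    = refl
≡ᵇ-refl (suc n) = ≡ᵇ-refl n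

lookup-ext : ∀ {n} {x y : Vec Bool n} → lookup x ≗ lookup y → x ≡ y
lookup-ext {x = x} {y} eq = trans (sym (tabulate∘lookup x)) (trans (tabulate-cong eq) (tabulate∘lookup y))

last-tabulate : ∀ {A : Set} n (f : Fin (suc n) → A) → last (tabulate f) ≡ f (fromℕ n)
last-tabulate zero    f = refl
last-tabulate (suc n) f = last-tabulate n (f ∘ suc)

toℕ-leftNode : ∀ ℓ k (i : Fin ℓ) → toℕ (leftNode ℓ (suc k) i) ≡ toℕ i
toℕ-leftNode ℓ k i = trans (toℕ-cast _ _) (toℕ-↑ˡ i k)

toℕ-rightNode-suc : ∀ a k (j : Fin k) → toℕ (rightNode (suc a) (suc k) (suc j)) ≡ suc a + toℕ j
toℕ-rightNode-suc a k j = trans (toℕ-cast _ _) (toℕ-↑ʳ (suc a) j)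

toℕ-pred : ∀ {n m} (i : Fin n) → toℕ i ≡ suc m → toℕ (pred i) ≡ m
toℕ-pred (suc i) eq = trans (toℕ-inject₁ i) (suc-injective eq)

-- With sizes `suc a` and `suc b`, the two nodes feeding node 0 lie at depths `a` and `b`.
module Circuit (a b : ℕ) where

  private
    ℓ r : ℕ
    ℓ = suc a
    r = suc b

    f : Config ℓ r → Config ℓ r
    f = F ℓ r

    root leftEnd rightEnd : Fin (size ℓ r)
    root     = leftNode ℓ r zero
    leftEnd  = leftNode ℓ r (fromℕ a)
    rightEnd = rightNode ℓ r (fromℕ b)

  -- The distance from node 0, along whichever circuit the node lies on.
  depth : ℕ → ℕ
  depth zero    = 0
  depth (suc n) = suc (if n ≡ᵇ a then 0 else depth n)

  depth-left : ∀ n → n ≤ a → depth n ≡ n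
  depth-left zero    _   = refl
  depth-left (suc n) n<a rewrite ≢⇒≡ᵇ-false (<⇒≢ n<a) = cong suc (depth-left n (<⇒≤ n<a))

  depth-right : ∀ j → depth (ℓ + j) ≡ suc j
  depth-right zero    rewrite +-identityʳ a | ≡ᵇ-refl a = refl
  depth-right (suc j) rewrite +-suc a j | ≢⇒≡ᵇ-false {suc a + j} {a} (λ eq → m+1+n≢m a (trans (+-suc a j) eq)) =
    cong suc (depth-right j)

  depth-root : depth (toℕ root) ≡ 0
  depth-root = cong depth (toℕ-leftNode ℓ b zero)

  depth-leftEnd : depth (toℕ leftEnd) ≡ a
  depth-leftEnd = trans (cong depth (trans (toℕ-leftNode ℓ b (fromℕ a)) (toℕ-fromℕ a))) (depth-left a ≤-refl)

  depth-rightNode : ∀ j → depth (toℕ (rightNode ℓ r j)) ≡ toℕ j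
  depth-rightNode zero    = depth-root
  depth-rightNode (suc j) = trans (cong depth (toℕ-rightNode-suc a b j)) (depth-right (toℕ j))

  depth-rightEnd : depth (toℕ rightEnd) ≡ b
  depth-rightEnd = trans (depth-rightNode (fromℕ b)) (toℕ-fromℕ b)

  F-zero : ∀ x i → toℕ i ≡ 0 → lookup (f x) i ≡ not (lookup x leftEnd) ∨ lookup x rightEnd
  F-zero x i eq = trans (lookup∘tabulate _ i) step
    where
    step : (if toℕ i ≡ᵇ 0 then not (last (leftPart ℓ r x)) ∨ last (rightPart ℓ r x)
            else if toℕ i ≡ᵇ ℓ then lookup x root else lookup x (pred i))
         ≡ not (lookup x leftEnd) ∨ lookup x rightEnd
    step rewrite eq = cong₂ (λ y z → not y ∨ z) (last-tabulate a (lookup x ∘ leftNode ℓ r)) (last-tabulate b (lookup x ∘ rightNode ℓ r))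

  F-suc : ∀ x i {n} → toℕ i ≡ suc n → lookup (f x) i ≡ (if n ≡ᵇ a then lookup x root else lookup x (pred i))
  F-suc x i {n} eq = trans (lookup∘tabulate _ i) step
    where
    step : (if toℕ i ≡ᵇ 0 then not (last (leftPart ℓ r x)) ∨ last (rightPart ℓ r x)
            else if toℕ i ≡ᵇ ℓ then lookup x root else lookup x (pred i))
         ≡ (if n ≡ᵇ a then lookup x root else lookup x (pred i))
    step rewrite eq = refl

  config : (ℕ → Bool) → Config ℓ r
  config w = tabulate λ i → w (depth (toℕ i))

  config-cong : ∀ {w v} → w ≗ v → config w ≡ config v
  config-cong eq = tabulate-cong λ i → eq (depth (toℕ i))

  lookup-config : ∀ w i {n} → depth (toℕ i) ≡ n → lookup (config w) i ≡ w n
  lookup-config w i eq = trans (lookup∘tabulate _ i) (cong w eq)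

  -- An update moves each state one depth further, so only the value at node 0 is new. Node `ℓ` fits
  -- the same pattern: its depth is 1 and it copies node 0.
  F-config : ∀ w v → v 0 ≡ not (w a) ∨ w b → (∀ n → v (suc n) ≡ w n) → f (config w) ≡ config v
  F-config w v eq₀ eqₛ = lookup-ext λ i → step i (toℕ i) refl
    where
    step : ∀ i n → toℕ i ≡ n → lookup (f (config w)) i ≡ lookup (config v) i
    step i zero eq = begin
      lookup (f (config w)) i
        ≡⟨ F-zero (config w) i eq ⟩
      not (lookup (config w) leftEnd) ∨ lookup (config w) rightEnd
        ≡⟨ cong₂ (λ y z → not y ∨ z) (lookup-config w leftEnd depth-leftEnd) (lookup-config w rightEnd depth-rightEnd) ⟩
      not (w a) ∨ w b
        ≡⟨ eq₀ ⟨
      v 0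
        ≡⟨ lookup-config v i (cong depth eq) ⟨
      lookup (config v) i ∎
    step i (suc n) eq = begin
      lookup (f (config w)) i
        ≡⟨ F-suc (config w) i eq ⟩
      (if n ≡ᵇ a then lookup (config w) root else lookup (config w) (pred i))
        ≡⟨ cong₂ (if n ≡ᵇ a then_else_) (lookup-config w root depth-root) (lookup-config w (pred i) (cong depth (toℕ-pred i eq))) ⟩
      (if n ≡ᵇ a then w 0 else w (depth n))
        ≡⟨ if-float w (n ≡ᵇ a) ⟨
      w (if n ≡ᵇ a then 0 else depth n)
        ≡⟨ eqₛ _ ⟨
      v (depth (suc n))
        ≡⟨ lookup-config v i (cong depth eq) ⟨
      lookup (config v) i ∎

  -- Induction peels off the last update, which copies the state from the preceding node, or from
  -- node 0 when the node is `ℓ`.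
  lookup-iterate-depth : ∀ n i → toℕ i ≡ n → ∀ x → lookup (iterate f x (depth n)) i ≡ lookup x root
  lookup-iterate-depth zero    i eq x = cong (lookup x) (toℕ-injective (trans eq (sym (toℕ-leftNode ℓ b zero))))
  lookup-iterate-depth (suc n) i eq x = trans (cong (λ y → lookup y i) (iterate-suc f x (if n ≡ᵇ a then 0 else depth n)))
    (trans (F-suc (iterate f x (if n ≡ᵇ a then 0 else depth n)) i eq) previous)
    where
    previous : (if n ≡ᵇ a then lookup (iterate f x (if n ≡ᵇ a then 0 else depth n)) root
                else lookup (iterate f x (if n ≡ᵇ a then 0 else depth n)) (pred i))
             ≡ lookup x root
    -- The same test selects the source node and the number of earlier steps, which is 0 if the
    -- source is node 0.
    previous with n ≡ᵇ a
    ... | true  = refl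
    ... | false = lookup-iterate-depth n (pred i) (toℕ-pred i eq) x

  -- Reading words off configurations

  module _ (q : ℕ) where

    private
      p : ℕ
      p = suc q

    -- Going back i steps in time is going forward i * q steps, as q ≡ -1.
    word : Config ℓ r → ℕ → Bool
    word x i = lookup (iterate f x (i * q)) root

    -- At depth `n` the word gives node 0 as it was `n` steps ago, reached by `n * q` forward steps;
    -- `n` more carry that state to the node. The total `n * p` returns to `x`.
    config-word : ∀ {x} → HasPeriod p ℓ r x → config (word x) ≡ x
    config-word {x} period = lookup-ext λ i → let n = depth (toℕ i) in begin
      lookup (config (word x)) i
        ≡⟨ lookup-config (word x) i refl ⟩
      lookup (iterate f x (n * q)) root
        ≡⟨ lookup-iterate-depth (toℕ i) i refl (iterate f x (n * q)) ⟨
      lookup (iterate f (iterate f x (n * q)) n) i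
        ≡⟨ cong (λ y → lookup y i) (iterate-+ f x (n * q) n) ⟨
      lookup (iterate f x (n * q + n)) i
        ≡⟨ cong (λ t → lookup (iterate f x t) i) (factor n q) ⟩
      lookup (iterate f x (n * p)) i
        ≡⟨ cong (λ y → lookup y i) (iterate-multiple f p period n) ⟩
      lookup x i ∎
      where
      factor : ∀ n q → n * q + n ≡ n * suc q
      factor = solve-∀

    word-respects : ∀ {x} → HasPeriod p ℓ r x → ∀ {m n} → m ≈ n [mod p ] → word x m ≡ word x n
    word-respects period m≈n = cong (λ y → lookup y root) (iterate-cong-≈ f p period (*-congʳ-≈ q m≈n))

    word-iterate : ∀ x s i → word (iterate f x (s * q)) i ≡ word x (s + i)
    word-iterate x s i = cong (λ y → lookup y root)
      (trans (sym (iterate-+ f x (s * q) (i * q))) (cong (iterate f x) (sym (*-distribʳ-+ q s i))))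

  -- The rule at node 0 as the covering condition

  module _ (q : ℕ) (p∣r : suc q ∣ r) where

    private
      p : ℕ
      p = suc q

      q≈b : q ≈ b [mod p ]
      q≈b = ∣⇒pred-≈ p∣r

    -- An update shifts the word by -1, represented by `q`. At node 0, `b` is also -1 modulo `p` and
    -- `a` is congruent to `ℓ + q`, so the rule reads `not (w (ℓ + q)) ∨ w q`, which equals `w q` by
    -- `covers` at `q`.
    F-admissible : ∀ {w} → Admissible p ℓ w → f (config w) ≡ config (λ i → w (q + i))
    F-admissible {w} adm = F-config w (λ i → w (q + i))
      (begin
        w (q + 0)          ≡⟨ cong w (+-identityʳ q) ⟩
        w q                ≡⟨ absorb (w q) (w (ℓ + q)) (covers adm q) ⟩
        not (w (ℓ + q)) ∨ w q
          ≡⟨ cong₂ (λ y z → not y ∨ z) (respects adm (0 , 1 , wrap a q)) (respects adm q≈b) ⟩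
        not (w a) ∨ w b    ∎)
      (λ n → respects adm (0 , 1 , wrap′ q n))
      where
      absorb : ∀ x y → x ∨ y ≡ true → x ≡ not y ∨ x
      absorb true  true  _ = refl
      absorb true  false _ = refl
      absorb false true  _ = refl
      wrap : ∀ a q → suc a + q + 0 * suc q ≡ a + 1 * suc q
      wrap = solve-∀
      wrap′ : ∀ q n → q + suc n + 0 * suc q ≡ n + 1 * suc q
      wrap′ = solve-∀

    iterate-admissible : ∀ {w} → Admissible p ℓ w → ∀ t → iterate f (config w) t ≡ config (λ i → w (t * q + i))
    iterate-admissible     adm zero    = refl
    iterate-admissible {w} adm (suc t) = begin
      iterate f (f (config w)) t
        ≡⟨ cong (λ y → iterate f y t) (F-admissible adm) ⟩
      iterate f (config (λ i → w (q + i))) t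
        ≡⟨ iterate-admissible (shift-admissible q adm) t ⟩
      config (λ i → w (q + (t * q + i)))
        ≡⟨ config-cong (λ i → cong w (sym (+-assoc q (t * q) i))) ⟩
      config (λ i → w (suc t * q + i)) ∎

    config-period : ∀ {w} → Admissible p ℓ w → HasPeriod p ℓ r (config w)
    config-period {w} adm = trans (iterate-admissible adm p)
      (config-cong λ i → respects adm (≈-trans (≈-reflexive (swap q i)) (+-multiple-≈ i q)))
      where
      swap : ∀ q i → suc q * q + i ≡ i + q * suc q
      swap = solve-∀

    -- Reading index `i` takes `i * q` updates, each shifting the word by `q`; as `q` is -1,
    -- `q * q ≈ 1` and the total shift is `i`.
    word-config : ∀ {w} → Admissible p ℓ w → word q (config w) ≗ w
    word-config {w} adm i = begin
      lookup (iterate f (config w) (i * q)) root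
        ≡⟨ cong (λ y → lookup y root) (iterate-admissible adm (i * q)) ⟩
      lookup (config (λ j → w (i * q * q + j))) root
        ≡⟨ lookup-config (λ j → w (i * q * q + j)) root depth-root ⟩
      w (i * q * q + 0)
        ≡⟨ respects adm (i , i * q , square i q) ⟩
      w i ∎
      where
      square : ∀ i q → i * q * q + 0 + i * suc q ≡ i + i * q * suc q
      square = solve-∀

    -- Since `q * q ≈ 1`, the entry at `q` is node 0 after one update. The rule with `b ≈ q` then
    -- gives an equation `x ≡ not y ∨ x`, which excludes that both are false.
    word-covers-q : ∀ {x} → HasPeriod p ℓ r x → word q x q ∨ word q x a ≡ true
    word-covers-q {x} period = covered (word q x q) (word q x a) (begin
      lookup (iterate f x (q * q)) root
        ≡⟨ cong (λ y → lookup y root) (iterate-cong-≈ f p period {n = 1} (2 , p , square q)) ⟩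
      lookup (f x) root
        ≡⟨ F-zero x root (toℕ-leftNode ℓ b zero) ⟩
      not (lookup x leftEnd) ∨ lookup x rightEnd
        ≡⟨ cong₂ (λ y z → not y ∨ z) (lookup-word leftEnd depth-leftEnd) (lookup-word rightEnd depth-rightEnd) ⟩
      not (word q x a) ∨ word q x b
        ≡⟨ cong (not (word q x a) ∨_) (word-respects q period q≈b) ⟨
      not (word q x a) ∨ word q x q ∎)
      where
      lookup-word : ∀ i {n} → depth (toℕ i) ≡ n → lookup x i ≡ word q x n
      lookup-word i eq = trans (cong (λ y → lookup y i) (sym (config-word q period))) (lookup-config (word q x) i eq)
      square : ∀ q → q * q + 2 * suc q ≡ 1 + suc q * suc q
      square = solve-∀
      covered : ∀ x y → x ≡ not y ∨ x → x ∨ y ≡ true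
      covered true  y     _ = refl
      covered false true  _ = refl

    -- The condition at `q` holds for every configuration on the orbit. Going back `suc t` steps
    -- moves the pair `q`, `a` to `t + p`, `ℓ + t`, which gives the condition at `t`.
    word-admissible : ∀ {x} → HasPeriod p ℓ r x → Admissible p ℓ (word q x)
    word-admissible {x} period = record
      { respects = word-respects q period
      ; covers   = λ t → begin
          word q x t ∨ word q x (ℓ + t)
            ≡⟨ cong₂ _∨_ (word-respects q period (1 , 0 , wrap t q)) (cong (word q x) (swap a t)) ⟩
          word q x (suc t + q) ∨ word q x (suc t + a)
            ≡⟨ cong₂ _∨_ (word-iterate q x (suc t) q) (word-iterate q x (suc t) a) ⟨
          word q (iterate f x (suc t * q)) q ∨ word q (iterate f x (suc t * q)) a
            ≡⟨ word-covers-q (iterate-period f p period (suc t * q)) ⟩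
          true ∎
      }
      where
      wrap : ∀ t q → t + 1 * suc q ≡ suc t + q + 0 * suc q
      wrap = solve-∀
      swap : ∀ a t → suc a + t ≡ suc t + a
      swap = solve-∀

-- Counting

lookup-injective : ∀ {A : Set} {xs : List A} → Unique xs → ∀ i j → lookupˡ xs i ≡ lookupˡ xs j → i ≡ j
lookup-injective (_  ∷ _)  zero    zero    _  = refl
lookup-injective (x∉ ∷ _)  zero    (suc j) eq = contradiction eq (lookupᵃ x∉ (∈-lookup j))
lookup-injective (x∉ ∷ _)  (suc i) zero    eq = contradiction (sym eq) (lookupᵃ x∉ (∈-lookup i))
lookup-injective (_  ∷ u)  (suc i) (suc j) eq = cong suc (lookup-injective u i j eq)

-- Each position in `xs` is sent to a position of its image in `ys`. This is injective because `g`
-- separates the elements of `xs` and no element is repeated.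
length-≤ : ∀ {A B : Set} {xs : List A} {ys : List B} (g : A → B) → Unique xs →
  (∀ {x} → x ∈ xs → g x ∈ ys) →
  (∀ {x y} → x ∈ xs → y ∈ xs → g x ≡ g y → x ≡ y) →
  length xs ≤ length ys
length-≤ {xs = xs} {ys} g unique maps inj = injective⇒≤ {f = h} λ {i} {j} eq →
  lookup-injective unique i j (inj (∈-lookup i) (∈-lookup j) (begin
    g (lookupˡ xs i)    ≡⟨ lookup-index (maps (∈-lookup i)) ⟩
    lookupˡ ys (h i)    ≡⟨ cong (lookupˡ ys) eq ⟩
    lookupˡ ys (h j)    ≡⟨ lookup-index (maps (∈-lookup j)) ⟨
    g (lookupˡ xs j)    ∎))
  where
  h : Fin (length xs) → Fin (length ys)
  h i = index (maps (∈-lookup i))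

-- A configuration is read as a word, reindexed by `ψ`, and written on the other circuit. Each stage
-- can be undone: `word-config` recovers the reindexed word, `reindex-injective` the original word,
-- and `config-word` the configuration.
C-≤ : ∀ q a b a′ b′ → suc q ∣ suc b → suc q ∣ suc b′ → Reindexing (suc q) (suc a) (suc a′) →
  C (suc q) (suc a) (suc b) ≤ C (suc q) (suc a′) (suc b′)
C-≤ q a b a′ b′ p∣r p∣r′ R = length-≤ transfer
  (filter-unique P? (allVecs-unique _))
  (λ x∈ → ∈-filter⁺ P′? (allVecs-complete _) (X′.config-period q p∣r′ (adm′ (period x∈))))
  (λ x∈ y∈ → injective (period x∈) (period y∈))
  where
  module X  = Circuit a b
  module X′ = Circuit a′ b′
  open Reindexing R using (ψ)

  P? = hasPeriod? (suc q) (suc a) (suc b)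
  P′? = hasPeriod? (suc q) (suc a′) (suc b′)

  period : ∀ {x} → x ∈ filter P? (allVecs _) → HasPeriod (suc q) (suc a) (suc b) x
  period x∈ = proj₂ (∈-filter⁻ P? {xs = allVecs _} x∈)

  word : Config (suc a) (suc b) → ℕ → Bool
  word = X.word q

  transfer : Config (suc a) (suc b) → Config (suc a′) (suc b′)
  transfer x = X′.config (word x ∘ ψ)

  adm′ : ∀ {x} → HasPeriod (suc q) (suc a) (suc b) x → Admissible (suc q) (suc a′) (word x ∘ ψ)
  adm′ per = reindex-admissible R (X.word-admissible q p∣r per)

  injective : ∀ {x y} → HasPeriod (suc q) (suc a) (suc b) x → HasPeriod (suc q) (suc a) (suc b) y →
    transfer x ≡ transfer y → x ≡ y
  injective {x} {y} px py eq = begin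
    x                    ≡⟨ X.config-word q px ⟨
    X.config (word x)    ≡⟨ X.config-cong (reindex-injective R (X.word-admissible q p∣r px) (X.word-admissible q p∣r py) same) ⟩
    X.config (word y)    ≡⟨ X.config-word q py ⟩
    y                    ∎
    where
    same : word x ∘ ψ ≗ word y ∘ ψ
    same t = begin
      word x (ψ t)                        ≡⟨ X′.word-config q p∣r′ (adm′ px) t ⟨
      X′.word q (transfer x) t       ≡⟨ cong (λ z → X′.word q z t) eq ⟩
      X′.word q (transfer y) t       ≡⟨ X′.word-config q p∣r′ (adm′ py) t ⟩
      word y (ψ t)                        ∎

-- Equality of the two counts

lemma1 : ∀ (p : ℕ) .{{_ : NonZero p}} (ℓ r ℓ′ r′ : ℕ)
    .{{_ : NonZero ℓ}} .{{_ : NonZero r}} .{{_ : NonZero ℓ′}} .{{_ : NonZero r′}} →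
    p ∣ r → p ∤ ℓ → p ∣ r′ → p ∤ ℓ′ →
    gcd ℓ p ≡ gcd ℓ′ p → C p ℓ r ≡ C p ℓ′ r′
lemma1 p@(suc q) ℓ@(suc a) (suc b) ℓ′@(suc a′) (suc b′) p∣r _ p∣r′ _ eq = ≤-antisym
  -- A common gcd `d` yields reindexings in both directions, one for each inequality.
  (C-≤ q a b a′ b′ p∣r p∣r′ (reindexing d g g′))
  (C-≤ q a′ b′ a b p∣r′ p∣r (reindexing d g′ g))
  where
  d = gcd ℓ p
  instance
    d≢0 : NonZero d
    d≢0 = ≢-nonZero (gcd[m,n]≢0 ℓ p (inj₂ λ ()))
  g : GCD ℓ p d
  g = gcd-GCD ℓ p
  g′ : GCD ℓ′ p d
  g′ = subst (GCD ℓ′ p) (sym eq) (gcd-GCD ℓ′ p)
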